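{- For every integer $n\ge 1$, the total number $r(n)$ of $(-1)$-Dyck paths of semi-length $n$ is given by $$r(n)=\sum_{\ell=0}^n\sum_{i=0}^{n-\ell-1}\binom{n-\ell-1}{i}q^{(i)}(\ell),$$ where $$q^{(i)}(n)=\sum_{n_1+n_2+\cdots+n_i=n}b(n_1)b(n_2)\cdots b(n_i),$$ the sum running over all $i$-tuples $(n_1,\dots,n_i)$ of nonnegative integers with sum $n$.
   Context: A Dyck path is a lattice path in the first quadrant that starts at the origin, ends on the $x$-axis, and consists of steps $U=(1,1)$ and $D=(1,-1)$ (never going below the $x$-axis). Its semi-length is its number of $U$ steps. A valley is an occurrence of two consecutive steps $DU$; the level of a valley is the $y$-coordinate of its lowest point. Let $\nu=(\nu_1,\dots,\nu_k)$ be the levels of all valleys of $P$, listed from left to right. A Dyck path is called $(-1)$-Dyck if it has at most one valley or if $\nu_{i+1}-\nu_i\ge -1$ for all $1\le i<k$. For $n\ge 0$, $b(n)$ is the number of $(-1)$-Dyck paths of semi-length $n$ that either have no valleys or whose last (rightmost) valley is at ground level (level $0$); the empty path is counted, so $b(0)=1$. By the empty-product convention, $q^{(0)}(0)=1$ and $q^{(0)}(n)=0$ for $n\ge 1$. Inner sums with upper limit $-1$ are empty. -}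

module Defs where

open import Data.Nat using (ℕ; zero; suc; _+_; _∸_; s≤s; s≤s⁻¹)
open import Data.Nat.ListAction using (sum; product)
open import Data.Nat.Properties using (_≟_; m+[n∸m]≡n; m+n∸m≡n; m≤m+n)
open import Data.Integer as ℤ using (+_; -1ℤ)
open import Data.List.Base
  using (List; []; _∷_; [_]; _++_; map; concatMap; filter; length; upTo; last)
import Data.List.Properties as Listₚ
open import Data.List.Membership.Propositional using (_∈_; find)
open import Data.List.Membership.Propositional.Properties
  using (∈-map⁺; ∈-map⁻; ∈-++⁺ˡ; ∈-++⁺ʳ; ∈-concatMap⁺; ∈-concatMap⁻; ∈-upTo⁺; ∈-upTo⁻)
open import Data.List.Relation.Binary.Disjoint.Propositional using (Disjoint)
open import Data.List.Relation.Unary.All as All using ([]; _∷_)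
import Data.List.Relation.Unary.All.Properties as Allₚ
open import Data.List.Relation.Unary.AllPairs as AllPairs using ([]; _∷_)
import Data.List.Relation.Unary.AllPairs.Properties as AllPairsₚ
open import Data.List.Relation.Unary.Any as Any using (here)
open import Data.List.Relation.Unary.Linked using (Linked; linked?)
open import Data.List.Relation.Unary.Unique.Propositional using (Unique)
import Data.List.Relation.Unary.Unique.Propositional.Properties as Uniqueₚ
open import Data.Maybe.Base using (just)
import Data.Maybe.Properties as Maybeₚ
open import Data.Product using (_,_)
open import Data.Sum using (_⊎_)
open import Data.Vec.Base as Vec using (Vec; []; _∷_)
open import Relation.Binary.PropositionalEquality using (_≡_; _≢_; refl; sym; trans; cong; subst)
open import Relation.Nullary.Decidable using (_×-dec_; _⊎-dec_)
open import Relation.Unary using (Decidable)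

-- Lattice paths with steps U and D that start at height h, never go below the
-- x-axis, end on it, and have exactly n up-steps.
data Path : ℕ → ℕ → Set where
  end : Path 0 0
  U   : ∀ {h n} → Path (suc h) n → Path h (suc n)
  D   : ∀ {h n} → Path h n → Path (suc h) n

DyckPath : ℕ → Set
DyckPath n = Path 0 n

-- In D (U {h} p), the path is at height h between the two steps.
valleyLevels : ∀ {h n} → Path h n → List ℕ
valleyLevels end             = []
valleyLevels (U p)           = valleyLevels p
valleyLevels (D end)         = []
valleyLevels (D (U {h} p))   = h ∷ valleyLevels p
valleyLevels (D (D p))       = valleyLevels (D p)

-- Linked is vacuous on lists with at most one element, so paths with at most
-- one valley qualify.
MinusOneDyck : ∀ {n} → DyckPath n → Set
MinusOneDyck p = Linked (λ ν ν′ → + ν′ ℤ.- + ν ℤ.≥ -1ℤ) (valleyLevels p)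

NoValleyOrLastAtGround : ∀ {n} → DyckPath n → Set
NoValleyOrLastAtGround p = valleyLevels p ≡ [] ⊎ last (valleyLevels p) ≡ just 0

minusOneDyck? : ∀ {n} → Decidable (MinusOneDyck {n})
minusOneDyck? p = linked? (λ ν ν′ → -1ℤ ℤ.≤? (+ ν′ ℤ.- + ν)) (valleyLevels p)

noValleyOrLastAtGround? : ∀ {n} → Decidable (NoValleyOrLastAtGround {n})
noValleyOrLastAtGround? p =
  Listₚ.≡-dec _≟_ (valleyLevels p) [] ⊎-dec Maybeₚ.≡-dec _≟_ (last (valleyLevels p)) (just 0)

-- A duplicate-free list of all paths; see ∈-paths and paths-unique.
paths : ∀ h n → List (Path h n)
paths zero    zero    = [ end ]
paths (suc h) zero    = map D (paths h zero)
paths zero    (suc n) = map U (paths 1 n)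
paths (suc h) (suc n) = map U (paths (suc (suc h)) n) ++ map D (paths h (suc n))

∈-paths : ∀ {h n} (p : Path h n) → p ∈ paths h n
∈-paths end                   = here refl
∈-paths (U {zero} p)          = ∈-map⁺ U (∈-paths p)
∈-paths (U {suc h} p)         = ∈-++⁺ˡ (∈-map⁺ U (∈-paths p))
∈-paths (D {h} {zero} p)      = ∈-map⁺ D (∈-paths p)
∈-paths (D {h} {suc n} p)     = ∈-++⁺ʳ (map U (paths (suc (suc h)) n)) (∈-map⁺ D (∈-paths p))

paths-unique : ∀ h n → Unique (paths h n)
paths-unique zero    zero    = [] ∷ []
paths-unique (suc h) zero    = Uniqueₚ.map⁺ (λ { refl → refl }) (paths-unique h zero)
paths-unique zero    (suc n) = Uniqueₚ.map⁺ (λ { refl → refl }) (paths-unique 1 n)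
paths-unique (suc h) (suc n) = Uniqueₚ.++⁺
  (Uniqueₚ.map⁺ (λ { refl → refl }) (paths-unique (suc (suc h)) n))
  (Uniqueₚ.map⁺ (λ { refl → refl }) (paths-unique h (suc n)))
  disjoint
  where
  disjoint : Disjoint (map U (paths (suc (suc h)) n)) (map D (paths h (suc n)))
  disjoint (x , y) with ∈-map⁻ U x | ∈-map⁻ D y
  ... | _ , _ , refl | _ , _ , ()

r : ℕ → ℕ
r n = length (filter minusOneDyck? (paths 0 n))

b : ℕ → ℕ
b n = length (filter (λ p → minusOneDyck? p ×-dec noValleyOrLastAtGround? p) (paths 0 n))

-- A duplicate-free list of all i-tuples of naturals with sum n;
-- see ∈-tuples⁺, ∈-tuples⁻ and tuples-unique.
tuples : ∀ i → ℕ → List (Vec ℕ i)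
tuples zero    zero    = [ [] ]
tuples zero    (suc n) = []
tuples (suc i) n       = concatMap (λ k → map (k ∷_) (tuples i (n ∸ k))) (upTo (suc n))

∈-tuples⁺ : ∀ {i} (v : Vec ℕ i) → v ∈ tuples i (Vec.sum v)
∈-tuples⁺ []      = here refl
∈-tuples⁺ (k ∷ v) = ∈-concatMap⁺ (λ j → map (j ∷_) (tuples _ (k + Vec.sum v ∸ j)))
  (Any.map (λ { refl → ∈-map⁺ (k ∷_)
      (subst (λ m → v ∈ tuples _ m) (sym (m+n∸m≡n k (Vec.sum v))) (∈-tuples⁺ v)) })
    (∈-upTo⁺ (s≤s (m≤m+n k (Vec.sum v)))))

∈-tuples⁻ : ∀ {i n} {v : Vec ℕ i} → v ∈ tuples i n → Vec.sum v ≡ n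
∈-tuples⁻ {zero}  {zero} (here refl) = refl
∈-tuples⁻ {suc i} {n} v∈
  with k , k∈ , v∈′ ← find (∈-concatMap⁻ (λ k → map (k ∷_) (tuples i (n ∸ k))) {xs = upTo (suc n)} v∈)
  with w , w∈ , refl ← ∈-map⁻ (k ∷_) v∈′
  = trans (cong (λ m → k + m) (∈-tuples⁻ w∈)) (m+[n∸m]≡n (s≤s⁻¹ (∈-upTo⁻ k∈)))

tuples-unique : ∀ i n → Unique (tuples i n)
tuples-unique zero    zero    = [] ∷ []
tuples-unique zero    (suc n) = []
tuples-unique (suc i) n       = Uniqueₚ.concat⁺
  (Allₚ.map⁺ (All.universal (λ k → Uniqueₚ.map⁺ (λ { refl → refl }) (tuples-unique i (n ∸ k))) (upTo (suc n))))
  (AllPairsₚ.map⁺ (AllPairs.map disjoint (Uniqueₚ.upTo⁺ (suc n))))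
  where
  disjoint : ∀ {j k} → j ≢ k → Disjoint (map (j ∷_) (tuples i (n ∸ j))) (map (k ∷_) (tuples i (n ∸ k)))
  disjoint {j} {k} j≢k (x , y) with ∈-map⁻ (j ∷_) x | ∈-map⁻ (k ∷_) y
  ... | _ , _ , refl | _ , _ , refl = j≢k refl

-- q i n is the value of q⁽ⁱ⁾ at n.
q : ℕ → ℕ → ℕ
q i n = sum (map (λ v → product (Vec.toList (Vec.map b v))) (tuples i n))

-- The sum of f i over 0 ≤ i < n; an upper limit m is written i < suc m.
∑< : ℕ → (ℕ → ℕ) → ℕ
∑< n f = sum (map f (upTo n))

infix 5 ∑<
syntax ∑< n (λ i → e) = ∑[ i < n ] e

{-# OPTIONS --safe #-}
module Submission where

-- Both sides of the identity, as functions of n ≥ 1, solve the recurrence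
--   x 1 = 1,   x (n + 2) = x (n + 1) + Σ_{k + l = n} b k * x (l + 1).
--
-- For r this is the first-return decomposition (sum-paths-join): a nonempty
-- Dyck path is U p D q with p and q Dyck paths, and its valleys are those of p
-- raised by one, followed, when q is nonempty, by a valley at level 0 and the
-- valleys of q. If q is empty, the path is (-1)-Dyck exactly when p is. If q is
-- nonempty, the valley at level 0 imposes no condition on the next one, while
-- the last valley of p, if any, must have level at most 1 after raising; so the
-- condition is that q is (-1)-Dyck and that p is counted by b
-- (linked-raise-++).
--
-- For the right-hand side, let a m ℓ = Σ_{i ≤ m} C(m, i) q⁽ⁱ⁾(ℓ), which is the
-- coefficient of x^ℓ in (1 + B)^m, where B is the generating function of b.
-- The right-hand side at n + 1 is the sum of a m ℓ over ℓ + m = n. Pascal's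
-- rule gives a (m + 1) ℓ = a m ℓ + Σ_{j + k = ℓ} b j * a m k (a-suc), and
-- summing it over the antidiagonals yields the recurrence (rhs-suc).

open import Defs
open import Algebra.Properties.CommutativeSemigroup using (interchange; x∙yz≈y∙xz)
open import Data.Bool.Base using (true; false; if_then_else_)
open import Data.Integer as ℤ using (-1ℤ; -≤+; -≤-)
import Data.Integer.Properties as ℤₚ
open import Data.List.Base
  using (List; []; _∷_; _++_; map; concatMap; filter; length; applyUpTo; upTo; last)
import Data.List.Properties as Listₚ
open import Data.List.Relation.Unary.Linked as Linked using (Linked; linked?; []; [-]; _∷_)
import Data.List.Relation.Unary.Linked.Properties as Linkedₚ
open import Data.Maybe.Base using (just)
import Data.Maybe.Properties as Maybeₚ
open import Data.Nat using (ℕ; zero; suc; _+_; _*_; _∸_; _≤_; _<_; z≤n; s≤s)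
open import Data.Nat.Combinatorics using (_C_; nCn≡1; nCk≡nC[n∸k]; k>n⇒nCk≡0; nCk+nC[k+1]≡[n+1]C[k+1])
open import Data.Nat.Induction using (<-rec)
open import Data.Nat.ListAction using (sum; product)
open import Data.Nat.ListAction.Properties using (sum-++)
open import Data.Nat.Properties
  using (_≟_; +-comm; +-assoc; +-identityʳ; *-comm; *-zeroʳ; *-distribˡ-+; *-distribʳ-+;
         m≤n+m; n<1+n; +-commutativeSemigroup; *-commutativeSemigroup)
open import Data.Product using (_×_; _,_)
open import Data.Sum using (_⊎_; inj₁; inj₂)
open import Data.Vec.Base as Vec using (_∷_)
open import Function.Base using (_∘_; id)
open import Function.Bundles using (_⇔_; mk⇔)
open import Relation.Binary.PropositionalEquality
  using (_≡_; refl; sym; trans; cong; cong₂; subst; module ≡-Reasoning)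
open import Relation.Nullary.Decidable using (Dec; does; does-⇔; _×-dec_; _⊎-dec_)
open import Relation.Unary using (Decidable)
open ≡-Reasoning

-- Sums over lists

sumOver : ∀ {A : Set} → List A → (A → ℕ) → ℕ
sumOver xs f = sum (map f xs)

sumOver-cong : ∀ {A : Set} (xs : List A) {f g : A → ℕ} → (∀ x → f x ≡ g x) → sumOver xs f ≡ sumOver xs g
sumOver-cong xs eq = cong sum (Listₚ.map-cong eq xs)

sumOver-++ : ∀ {A : Set} (xs ys : List A) (f : A → ℕ) → sumOver (xs ++ ys) f ≡ sumOver xs f + sumOver ys f
sumOver-++ xs ys f = trans (cong sum (Listₚ.map-++ f xs ys)) (sum-++ (map f xs) (map f ys))

sumOver-map : ∀ {A B : Set} (g : A → B) (xs : List A) (f : B → ℕ) → sumOver (map g xs) f ≡ sumOver xs (f ∘ g)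
sumOver-map g xs f = cong sum (sym (Listₚ.map-∘ xs))

sumOver-concatMap : ∀ {A B : Set} (g : A → List B) (xs : List A) (f : B → ℕ) →
  sumOver (concatMap g xs) f ≡ sumOver xs (λ x → sumOver (g x) f)
sumOver-concatMap g []       f = refl
sumOver-concatMap g (x ∷ xs) f =
  trans (sumOver-++ (g x) (concatMap g xs) f) (cong (sumOver (g x) f +_) (sumOver-concatMap g xs f))

sumOver-*ˡ : ∀ {A : Set} (xs : List A) c (f : A → ℕ) → sumOver xs (λ x → c * f x) ≡ c * sumOver xs f
sumOver-*ˡ []       c f = sym (*-zeroʳ c)
sumOver-*ˡ (x ∷ xs) c f =
  trans (cong (c * f x +_) (sumOver-*ˡ xs c f)) (sym (*-distribˡ-+ c (f x) (sumOver xs f)))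

sumOver-*ʳ : ∀ {A : Set} (xs : List A) c (f : A → ℕ) → sumOver xs (λ x → f x * c) ≡ sumOver xs f * c
sumOver-*ʳ xs c f = begin
  sumOver xs (λ x → f x * c) ≡⟨ sumOver-cong xs (λ x → *-comm (f x) c) ⟩
  sumOver xs (λ x → c * f x) ≡⟨ sumOver-*ˡ xs c f ⟩
  c * sumOver xs f           ≡⟨ *-comm c _ ⟩
  sumOver xs f * c           ∎

-- The indicator of a decided proposition.
⟦_⟧ : ∀ {P : Set} → Dec P → ℕ
⟦ P? ⟧ = if does P? then 1 else 0

⟦⟧-⇔ : ∀ {P Q : Set} → P ⇔ Q → (P? : Dec P) (Q? : Dec Q) → ⟦ P? ⟧ ≡ ⟦ Q? ⟧
⟦⟧-⇔ P⇔Q P? Q? = cong (if_then 1 else 0) (does-⇔ P⇔Q P? Q?)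

⟦⟧-× : ∀ {P Q : Set} (P? : Dec P) (Q? : Dec Q) → ⟦ P? ×-dec Q? ⟧ ≡ ⟦ P? ⟧ * ⟦ Q? ⟧
⟦⟧-× P? Q? with does P?
... | true  = sym (+-identityʳ _)
... | false = refl

length-filter-⟦⟧ : ∀ {A : Set} {P : A → Set} (P? : Decidable P) (xs : List A) →
  length (filter P? xs) ≡ sumOver xs (λ x → ⟦ P? x ⟧)
length-filter-⟦⟧ P? []       = refl
length-filter-⟦⟧ P? (x ∷ xs) with does (P? x)
... | true  = cong suc (length-filter-⟦⟧ P? xs)
... | false = length-filter-⟦⟧ P? xs

-- Sums over antidiagonals

-- The sum of g k l over all pairs with k + l ≡ n.
antidiag : ℕ → (ℕ → ℕ → ℕ) → ℕ
antidiag zero    g = g 0 0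
antidiag (suc n) g = g 0 (suc n) + antidiag n (λ k l → g (suc k) l)

antidiag-cong-≡ : ∀ n {f g : ℕ → ℕ → ℕ} → (∀ k l → k + l ≡ n → f k l ≡ g k l) → antidiag n f ≡ antidiag n g
antidiag-cong-≡ zero    eq = eq 0 0 refl
antidiag-cong-≡ (suc n) eq =
  cong₂ _+_ (eq 0 (suc n) refl) (antidiag-cong-≡ n (λ k l k+l≡n → eq (suc k) l (cong suc k+l≡n)))

antidiag-cong : ∀ n {f g : ℕ → ℕ → ℕ} → (∀ k l → f k l ≡ g k l) → antidiag n f ≡ antidiag n g
antidiag-cong n eq = antidiag-cong-≡ n (λ k l _ → eq k l)

antidiag-+ : ∀ n (f g : ℕ → ℕ → ℕ) → antidiag n (λ k l → f k l + g k l) ≡ antidiag n f + antidiag n g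
antidiag-+ zero    f g = refl
antidiag-+ (suc n) f g =
  trans (cong (f 0 (suc n) + g 0 (suc n) +_) (antidiag-+ n _ _))
        (interchange +-commutativeSemigroup (f 0 (suc n)) (g 0 (suc n)) _ _)

antidiag-*ˡ : ∀ n c (f : ℕ → ℕ → ℕ) → antidiag n (λ k l → c * f k l) ≡ c * antidiag n f
antidiag-*ˡ zero    c f = refl
antidiag-*ˡ (suc n) c f =
  trans (cong (c * f 0 (suc n) +_) (antidiag-*ˡ n c _)) (sym (*-distribˡ-+ c (f 0 (suc n)) _))

-- The defining recursion splits off the pair (0 , suc n); this splits off the
-- pair (suc n , 0).
antidiag-last : ∀ n (g : ℕ → ℕ → ℕ) → antidiag (suc n) g ≡ g (suc n) 0 + antidiag n (λ k l → g k (suc l))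
antidiag-last zero    g = +-comm (g 0 1) (g 1 0)
antidiag-last (suc n) g =
  trans (cong (g 0 (suc (suc n)) +_) (antidiag-last n (λ k l → g (suc k) l)))
        (x∙yz≈y∙xz +-commutativeSemigroup (g 0 (suc (suc n))) (g (suc (suc n)) 0) _)

-- Both sides sum h j k m over all triples with j + k + m ≡ n.
antidiag-assoc : ∀ n (h : ℕ → ℕ → ℕ → ℕ) →
  antidiag n (λ ℓ m → antidiag ℓ (λ j k → h j k m)) ≡ antidiag n (λ j s → antidiag s (λ k m → h j k m))
antidiag-assoc zero    h = refl
antidiag-assoc (suc n) h = begin
  h 0 0 (suc n) + antidiag n (λ ℓ m → h 0 (suc ℓ) m + antidiag ℓ (λ j k → h (suc j) k m))
    ≡⟨ cong (h 0 0 (suc n) +_) (antidiag-+ n _ _) ⟩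
  h 0 0 (suc n) + (antidiag n (λ ℓ m → h 0 (suc ℓ) m) + antidiag n (λ ℓ m → antidiag ℓ (λ j k → h (suc j) k m)))
    ≡⟨ +-assoc (h 0 0 (suc n)) _ _ ⟨
  antidiag (suc n) (h 0) + antidiag n (λ ℓ m → antidiag ℓ (λ j k → h (suc j) k m))
    ≡⟨ cong (antidiag (suc n) (h 0) +_) (antidiag-assoc n (h ∘ suc)) ⟩
  antidiag (suc n) (h 0) + antidiag n (λ j s → antidiag s (h (suc j))) ∎

antidiag-exchange : ∀ m n (h : ℕ → ℕ → ℕ → ℕ → ℕ) →
  antidiag m (λ i i′ → antidiag n (h i i′)) ≡ antidiag n (λ j j′ → antidiag m (λ i i′ → h i i′ j j′))
antidiag-exchange zero    n h = refl
antidiag-exchange (suc m) n h =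
  trans (cong (antidiag n (h 0 (suc m)) +_) (antidiag-exchange m n (h ∘ suc))) (sym (antidiag-+ n _ _))

sum-applyUpTo : ∀ n (f : ℕ → ℕ → ℕ) → sum (applyUpTo (λ k → f k (n ∸ k)) (suc n)) ≡ antidiag n f
sum-applyUpTo zero    f = +-identityʳ (f 0 0)
sum-applyUpTo (suc n) f = cong (f 0 (suc n) +_) (sum-applyUpTo n (f ∘ suc))

∑<-antidiag : ∀ n (f : ℕ → ℕ → ℕ) → ∑< (suc n) (λ k → f k (n ∸ k)) ≡ antidiag n f
∑<-antidiag n f =
  trans (cong sum (Listₚ.map-applyUpTo id (λ k → f k (n ∸ k)) (suc n))) (sum-applyUpTo n f)

-- The first-return decomposition

-- From p and q, the path p D q that starts at height h + 1 and first falls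
-- below height 1 at the displayed D. Here p is traversed one level higher than
-- its index says. For h = 0, U (join p q) is the path U p D q.
join : ∀ {h k l} → Path h k → Path 0 l → Path (suc h) (k + l)
join end   q = D q
join (U p) q = U (join p q)
join (D p) q = D (join p q)

sum-paths-U-D : ∀ h n (f : Path (suc h) (suc n) → ℕ) →
  sumOver (paths (suc h) (suc n)) f ≡ sumOver (paths (suc (suc h)) n) (f ∘ U) + sumOver (paths h (suc n)) (f ∘ D)
sum-paths-U-D h n f =
  trans (sumOver-++ (map U (paths (suc (suc h)) n)) _ f)
        (cong₂ _+_ (sumOver-map U (paths (suc (suc h)) n) f) (sumOver-map D (paths h (suc n)) f))

-- Every path from height h + 1 is join p q for exactly one pair (p , q).
sum-paths-join : ∀ h n (f : ∀ {m} → Path (suc h) m → ℕ) →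
  sumOver (paths (suc h) n) f ≡
  antidiag n (λ k l → sumOver (paths h k) (λ p → sumOver (paths 0 l) (λ q → f (join p q))))
sum-paths-join zero zero f = sym (+-identityʳ _)
sum-paths-join zero (suc n) f = begin
  sumOver (paths 1 (suc n)) f
    ≡⟨ sum-paths-U-D 0 n f ⟩
  sumOver (paths 2 n) (f ∘ U) + sumOver (paths 0 (suc n)) (f ∘ D)
    ≡⟨ +-comm (sumOver (paths 2 n) (f ∘ U)) _ ⟩
  sumOver (paths 0 (suc n)) (f ∘ D) + sumOver (paths 2 n) (f ∘ U)
    ≡⟨ cong₂ _+_ (sym (+-identityʳ _)) (sum-paths-join 1 n (f ∘ U)) ⟩
  sumOver (paths 0 0) (λ p → sumOver (paths 0 (suc n)) (λ q → f (join p q))) +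
  antidiag n (λ k l → sumOver (paths 1 k) (λ p → sumOver (paths 0 l) (λ q → f (U (join p q)))))
    ≡⟨ cong (sumOver (paths 0 0) (λ p → sumOver (paths 0 (suc n)) (λ q → f (join p q))) +_)
            (antidiag-cong n (λ k l → sumOver-map U (paths 1 k) _)) ⟨
  antidiag (suc n) (λ k l → sumOver (paths 0 k) (λ p → sumOver (paths 0 l) (λ q → f (join p q)))) ∎
sum-paths-join (suc h) zero f = begin
  sumOver (map D (paths (suc h) 0)) f
    ≡⟨ sumOver-map D (paths (suc h) 0) f ⟩
  sumOver (paths (suc h) 0) (f ∘ D)
    ≡⟨ sum-paths-join h zero (f ∘ D) ⟩
  sumOver (paths h 0) (λ p → sumOver (paths 0 0) (λ q → f (D (join p q))))
    ≡⟨ sumOver-map D (paths h 0) _ ⟨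
  sumOver (map D (paths h 0)) (λ p → sumOver (paths 0 0) (λ q → f (join p q))) ∎
sum-paths-join (suc h) (suc n) f = begin
  sumOver (paths (suc (suc h)) (suc n)) f
    ≡⟨ sum-paths-U-D (suc h) n f ⟩
  sumOver (paths (suc (suc (suc h))) n) (f ∘ U) + sumOver (paths (suc h) (suc n)) (f ∘ D)
    ≡⟨ cong₂ _+_ (sum-paths-join (suc (suc h)) n (f ∘ U)) (sum-paths-join h (suc n) (f ∘ D)) ⟩
  antidiag n viaU + (viaD 0 (suc n) + antidiag n (viaD ∘ suc))
    ≡⟨ x∙yz≈y∙xz +-commutativeSemigroup (antidiag n viaU) (viaD 0 (suc n)) _ ⟩
  viaD 0 (suc n) + (antidiag n viaU + antidiag n (viaD ∘ suc))
    ≡⟨ cong₂ _+_ (sumOver-map D (paths h 0) _) (antidiag-+ n viaU (viaD ∘ suc)) ⟨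
  sumOver (paths (suc h) 0) (λ p → sumOver (paths 0 (suc n)) (λ q → f (join p q))) +
  antidiag n (λ k l → viaU k l + viaD (suc k) l)
    ≡⟨ cong (sumOver (paths (suc h) 0) (λ p → sumOver (paths 0 (suc n)) (λ q → f (join p q))) +_)
            (antidiag-cong n (λ k l → sum-paths-U-D h k _)) ⟨
  antidiag (suc n) (λ k l → sumOver (paths (suc h) k) (λ p → sumOver (paths 0 l) (λ q → f (join p q)))) ∎
  where
  viaU viaD : ℕ → ℕ → ℕ
  viaU k l = sumOver (paths (suc (suc h)) k) (λ p → sumOver (paths 0 l) (λ q → f (U (join p q))))
  viaD k l = sumOver (paths h k) (λ p → sumOver (paths 0 l) (λ q → f (D (join p q))))

-- Valleys of a joined path

valleyLevels-join : ∀ {h k l} (p : Path h k) (q : Path 0 l) →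
  valleyLevels (join p q) ≡ map suc (valleyLevels p) ++ valleyLevels (D q)
valleyLevels-join end         q = refl
valleyLevels-join (U p)       q = valleyLevels-join p q
valleyLevels-join (D end)     q = refl
valleyLevels-join (D (U p))   q = cong (_ ∷_) (valleyLevels-join p q)
valleyLevels-join (D (D p))   q = valleyLevels-join (D p) q

valleyLevels-D : ∀ {l} (q : Path 0 (suc l)) → valleyLevels (D q) ≡ 0 ∷ valleyLevels q
valleyLevels-D (U q) = refl

-- The condition imposed on two consecutive valley levels.
Step : ℕ → ℕ → Set
Step ν ν′ = ℤ.+ ν′ ℤ.- ℤ.+ ν ℤ.≥ -1ℤ

-- The condition defining the paths counted by b, on their valley levels, apart
-- from being (-1)-Dyck.
Grounded : List ℕ → Set
Grounded vs = vs ≡ [] ⊎ last vs ≡ just 0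

step? : ∀ ν ν′ → Dec (Step ν ν′)
step? ν ν′ = -1ℤ ℤ.≤? (ℤ.+ ν′ ℤ.- ℤ.+ ν)

linked-step? : Decidable (Linked Step)
linked-step? = linked? step?

grounded? : Decidable Grounded
grounded? vs = Listₚ.≡-dec _≟_ vs [] ⊎-dec Maybeₚ.≡-dec _≟_ (last vs) (just 0)

difference-suc : ∀ m n → ℤ.+ suc m ℤ.- ℤ.+ suc n ≡ ℤ.+ m ℤ.- ℤ.+ n
difference-suc m n = trans (ℤₚ.[1+m]⊖[1+n]≡m⊖n m n) (sym (ℤₚ.[+m]-[+n]≡m⊖n m n))

step-raise : ∀ ν ν′ → Step ν ν′ → Step (suc ν) (suc ν′)
step-raise ν ν′ = subst (-1ℤ ℤ.≤_) (sym (difference-suc ν′ ν))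

step-lower : ∀ ν ν′ → Step (suc ν) (suc ν′) → Step ν ν′
step-lower ν ν′ = subst (-1ℤ ℤ.≤_) (difference-suc ν′ ν)

linked-0∷ : ∀ {ws} → Linked Step ws → Linked Step (0 ∷ ws)
linked-0∷ []         = [-]
linked-0∷ [-]        = -≤+ ∷ [-]
linked-0∷ (s ∷ l)    = -≤+ ∷ (s ∷ l)

linked-raise : ∀ vs → Linked Step (map suc vs) ⇔ Linked Step vs
linked-raise vs = mk⇔
  (Linked.map (λ {ν} {ν′} → step-lower ν ν′) ∘ Linkedₚ.map⁻)
  (Linkedₚ.map⁺ ∘ Linked.map (λ {ν} {ν′} → step-raise ν ν′))

-- A raised level list may be followed by a valley at level 0 exactly when the
-- raised last level is at most 1, that is, when the last level is 0.
linked-raise-++ : ∀ vs ws →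
  Linked Step (map suc vs ++ 0 ∷ ws) ⇔ ((Linked Step vs × Grounded vs) × Linked Step ws)
linked-raise-++ vs ws = mk⇔ (to vs) (λ { ((l , g) , l′) → from vs l g l′ })
  where
  to : ∀ vs → Linked Step (map suc vs ++ 0 ∷ ws) → (Linked Step vs × Grounded vs) × Linked Step ws
  to []            l              = ([] , inj₁ refl) , Linked.tail l
  to (zero ∷ [])   (_ ∷ l)        = ([-] , inj₂ refl) , Linked.tail l
  to (suc v ∷ [])  (-≤- () ∷ l)
  to (v ∷ v′ ∷ vs) (s ∷ l) with to (v′ ∷ vs) l
  ... | (l₁ , inj₂ e) , l₂ = (step-lower v v′ s ∷ l₁ , inj₂ e) , l₂

  from : ∀ vs → Linked Step vs → Grounded vs → Linked Step ws → Linked Step (map suc vs ++ 0 ∷ ws)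
  from []            _       _           l′ = linked-0∷ l′
  from (v ∷ [])      _       (inj₂ refl) l′ = -≤- z≤n ∷ linked-0∷ l′
  from (v ∷ v′ ∷ vs) (s ∷ l) (inj₂ e)    l′ = step-raise v v′ s ∷ from (v′ ∷ vs) l (inj₂ e) l′

-- The recurrence for r

-- The indicators of the paths counted by r and by b, as functions of the list
-- of valley levels.
χr χb : List ℕ → ℕ
χr vs = ⟦ linked-step? vs ⟧
χb vs = ⟦ linked-step? vs ×-dec grounded? vs ⟧

r-sum : ∀ n → r n ≡ sumOver (paths 0 n) (χr ∘ valleyLevels)
r-sum n = length-filter-⟦⟧ minusOneDyck? (paths 0 n)

b-sum : ∀ n → b n ≡ sumOver (paths 0 n) (χb ∘ valleyLevels)
b-sum n = length-filter-⟦⟧ (λ p → minusOneDyck? p ×-dec noValleyOrLastAtGround? p) (paths 0 n)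

χr-join-end : ∀ {k} (p : Path 0 k) → χr (valleyLevels (join p end)) ≡ χr (valleyLevels p)
χr-join-end p = begin
  χr (valleyLevels (join p end))       ≡⟨ cong χr (valleyLevels-join p end) ⟩
  χr (map suc (valleyLevels p) ++ [])  ≡⟨ cong χr (Listₚ.++-identityʳ (map suc (valleyLevels p))) ⟩
  χr (map suc (valleyLevels p))        ≡⟨ ⟦⟧-⇔ (linked-raise (valleyLevels p)) (linked-step? _) (linked-step? _) ⟩
  χr (valleyLevels p)                  ∎

χr-join : ∀ {k l} (p : Path 0 k) (q : Path 0 (suc l)) →
  χr (valleyLevels (join p q)) ≡ χb (valleyLevels p) * χr (valleyLevels q)
χr-join p q = begin
  χr (valleyLevels (join p q))
    ≡⟨ cong χr (valleyLevels-join p q) ⟩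
  χr (map suc (valleyLevels p) ++ valleyLevels (D q))
    ≡⟨ cong (λ ws → χr (map suc (valleyLevels p) ++ ws)) (valleyLevels-D q) ⟩
  χr (map suc (valleyLevels p) ++ 0 ∷ valleyLevels q)
    ≡⟨ ⟦⟧-⇔ (linked-raise-++ (valleyLevels p) (valleyLevels q)) (linked-step? _) (p? ×-dec linked-step? _) ⟩
  ⟦ p? ×-dec linked-step? (valleyLevels q) ⟧
    ≡⟨ ⟦⟧-× p? (linked-step? (valleyLevels q)) ⟩
  χb (valleyLevels p) * χr (valleyLevels q) ∎
  where
  p? : Dec (Linked Step (valleyLevels p) × Grounded (valleyLevels p))
  p? = linked-step? (valleyLevels p) ×-dec grounded? (valleyLevels p)

sum-χr-end : ∀ k → sumOver (paths 0 k) (λ p → sumOver (paths 0 0) (λ q → χr (valleyLevels (join p q)))) ≡ r k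
sum-χr-end k = trans
  (sumOver-cong (paths 0 k) (λ p → trans (+-identityʳ _) (χr-join-end p)))
  (sym (r-sum k))

sum-χr-join : ∀ k l →
  sumOver (paths 0 k) (λ p → sumOver (paths 0 (suc l)) (λ q → χr (valleyLevels (join p q)))) ≡ b k * r (suc l)
sum-χr-join k l = begin
  sumOver (paths 0 k) (λ p → sumOver (paths 0 (suc l)) (λ q → χr (valleyLevels (join p q))))
    ≡⟨ sumOver-cong (paths 0 k) (λ p → sumOver-cong (paths 0 (suc l)) (χr-join p)) ⟩
  sumOver (paths 0 k) (λ p → sumOver (paths 0 (suc l)) (λ q → χb (valleyLevels p) * χr (valleyLevels q)))
    ≡⟨ sumOver-cong (paths 0 k) (λ p → sumOver-*ˡ (paths 0 (suc l)) (χb (valleyLevels p)) _) ⟩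
  sumOver (paths 0 k) (λ p → χb (valleyLevels p) * sumOver (paths 0 (suc l)) (χr ∘ valleyLevels))
    ≡⟨ sumOver-*ʳ (paths 0 k) _ (χb ∘ valleyLevels) ⟩
  sumOver (paths 0 k) (χb ∘ valleyLevels) * sumOver (paths 0 (suc l)) (χr ∘ valleyLevels)
    ≡⟨ cong₂ _*_ (b-sum k) (r-sum (suc l)) ⟨
  b k * r (suc l) ∎

r-suc : ∀ n → r (suc (suc n)) ≡ r (suc n) + antidiag n (λ k l → b k * r (suc l))
r-suc n = begin
  r (suc (suc n))
    ≡⟨ r-sum (suc (suc n)) ⟩
  sumOver (map U (paths 1 (suc n))) (χr ∘ valleyLevels)
    ≡⟨ sumOver-map U (paths 1 (suc n)) (χr ∘ valleyLevels) ⟩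
  sumOver (paths 1 (suc n)) (χr ∘ valleyLevels)
    ≡⟨ sum-paths-join 0 (suc n) (χr ∘ valleyLevels) ⟩
  antidiag (suc n) (λ k l → sumOver (paths 0 k) (λ p → sumOver (paths 0 l) (λ q → χr (valleyLevels (join p q)))))
    -- the pair (suc n , 0) is the case of an empty second factor
    ≡⟨ antidiag-last n (λ k l →
         sumOver (paths 0 k) (λ p → sumOver (paths 0 l) (λ q → χr (valleyLevels (join p q))))) ⟩
  sumOver (paths 0 (suc n)) (λ p → sumOver (paths 0 0) (λ q → χr (valleyLevels (join p q)))) +
  antidiag n (λ k l → sumOver (paths 0 k) (λ p → sumOver (paths 0 (suc l)) (λ q → χr (valleyLevels (join p q)))))
    ≡⟨ cong₂ _+_ (sum-χr-end (suc n)) (antidiag-cong n sum-χr-join) ⟩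
  r (suc n) + antidiag n (λ k l → b k * r (suc l)) ∎

-- The recurrence for the binomial sum

q-suc : ∀ i n → q (suc i) n ≡ antidiag n (λ j k → b j * q i k)
q-suc i n = begin
  q (suc i) n
    ≡⟨ sumOver-concatMap (λ j → map (j ∷_) (tuples i (n ∸ j))) (upTo (suc n)) weight ⟩
  ∑< (suc n) (λ j → sumOver (map (j ∷_) (tuples i (n ∸ j))) weight)
    ≡⟨ sumOver-cong (upTo (suc n)) (λ j → trans (sumOver-map (j ∷_) (tuples i (n ∸ j)) weight)
                                                (sumOver-*ˡ (tuples i (n ∸ j)) (b j) weight)) ⟩
  ∑< (suc n) (λ j → b j * q i (n ∸ j))
    ≡⟨ ∑<-antidiag n (λ j k → b j * q i k) ⟩
  antidiag n (λ j k → b j * q i k) ∎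
  where
  weight : ∀ {i} → Vec.Vec ℕ i → ℕ
  weight v = product (Vec.toList (Vec.map b v))

-- a m ℓ is the sum of C(m, i) q⁽ⁱ⁾(ℓ) over i ≤ m, the coefficient of x^ℓ in
-- (1 + B)^m. The index i is the first component of an antidiagonal pair.
a : ℕ → ℕ → ℕ
a m ℓ = antidiag m (λ i _ → (m C i) * q i ℓ)

nC0≡1 : ∀ n → n C 0 ≡ 1
nC0≡1 n = trans (nCk≡nC[n∸k] {0} {n} z≤n) (nCn≡1 n)

pascal-antidiag : ∀ m (f : ℕ → ℕ) →
  antidiag (suc m) (λ i _ → (suc m C i) * f i) ≡
  antidiag m (λ i _ → (m C i) * f i) + antidiag m (λ i _ → (m C i) * f (suc i))
pascal-antidiag m f = begin
  (suc m C 0) * f 0 + antidiag m (λ i _ → (suc m C suc i) * f (suc i))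
    ≡⟨ cong₂ _+_ (cong (_* f 0) (trans (nC0≡1 (suc m)) (sym (nC0≡1 m)))) (antidiag-cong m split) ⟩
  (m C 0) * f 0 + antidiag m (λ i _ → (m C suc i) * f (suc i) + (m C i) * f (suc i))
    ≡⟨ cong ((m C 0) * f 0 +_) (antidiag-+ m _ _) ⟩
  (m C 0) * f 0 + (antidiag m (λ i _ → (m C suc i) * f (suc i)) + antidiag m (λ i _ → (m C i) * f (suc i)))
    ≡⟨ +-assoc ((m C 0) * f 0) _ _ ⟨
  antidiag (suc m) (λ i _ → (m C i) * f i) + antidiag m (λ i _ → (m C i) * f (suc i))
    ≡⟨ cong (_+ antidiag m (λ i _ → (m C i) * f (suc i))) (antidiag-last m (λ i _ → (m C i) * f i)) ⟩
  (m C suc m) * f (suc m) + antidiag m (λ i _ → (m C i) * f i) + antidiag m (λ i _ → (m C i) * f (suc i))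
    ≡⟨ cong (λ c → c * f (suc m) + antidiag m (λ i _ → (m C i) * f i) + antidiag m (λ i _ → (m C i) * f (suc i)))
            (k>n⇒nCk≡0 (n<1+n m)) ⟩
  antidiag m (λ i _ → (m C i) * f i) + antidiag m (λ i _ → (m C i) * f (suc i)) ∎
  where
  split : ∀ i (_ : ℕ) → (suc m C suc i) * f (suc i) ≡ (m C suc i) * f (suc i) + (m C i) * f (suc i)
  split i _ = begin
    (suc m C suc i) * f (suc i)                   ≡⟨ cong (_* f (suc i)) (nCk+nC[k+1]≡[n+1]C[k+1] m i) ⟨
    (m C i + m C suc i) * f (suc i)               ≡⟨ *-distribʳ-+ (f (suc i)) (m C i) (m C suc i) ⟩
    (m C i) * f (suc i) + (m C suc i) * f (suc i) ≡⟨ +-comm ((m C i) * f (suc i)) _ ⟩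
    (m C suc i) * f (suc i) + (m C i) * f (suc i) ∎

-- The coefficientwise form of (1 + B)^(m+1) = (1 + B)^m + B (1 + B)^m.
a-suc : ∀ m ℓ → a (suc m) ℓ ≡ a m ℓ + antidiag ℓ (λ j k → b j * a m k)
a-suc m ℓ = begin
  a (suc m) ℓ
    ≡⟨ pascal-antidiag m (λ i → q i ℓ) ⟩
  a m ℓ + antidiag m (λ i _ → (m C i) * q (suc i) ℓ)
    ≡⟨ cong (a m ℓ +_) (antidiag-cong m expand) ⟩
  a m ℓ + antidiag m (λ i _ → antidiag ℓ (λ j k → b j * ((m C i) * q i k)))
    ≡⟨ cong (a m ℓ +_) (antidiag-exchange m ℓ _) ⟩
  a m ℓ + antidiag ℓ (λ j k → antidiag m (λ i _ → b j * ((m C i) * q i k)))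
    ≡⟨ cong (a m ℓ +_) (antidiag-cong ℓ (λ j k → antidiag-*ˡ m (b j) _)) ⟩
  a m ℓ + antidiag ℓ (λ j k → b j * a m k) ∎
  where
  expand : ∀ i (_ : ℕ) → (m C i) * q (suc i) ℓ ≡ antidiag ℓ (λ j k → b j * ((m C i) * q i k))
  expand i _ = begin
    (m C i) * q (suc i) ℓ                            ≡⟨ cong ((m C i) *_) (q-suc i ℓ) ⟩
    (m C i) * antidiag ℓ (λ j k → b j * q i k)       ≡⟨ antidiag-*ˡ ℓ (m C i) _ ⟨
    antidiag ℓ (λ j k → (m C i) * (b j * q i k))
      ≡⟨ antidiag-cong ℓ (λ j k → x∙yz≈y∙xz *-commutativeSemigroup (m C i) (b j) (q i k)) ⟩
    antidiag ℓ (λ j k → b j * ((m C i) * q i k))     ∎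

-- The value of the double sum of the theorem at n + 1.
rhs : ℕ → ℕ
rhs n = antidiag n (λ ℓ m → a m ℓ)

rhs-suc : ∀ n → rhs (suc n) ≡ rhs n + antidiag n (λ j s → b j * rhs s)
rhs-suc n = begin
  antidiag (suc n) (λ ℓ m → a m ℓ)
    -- the term split off is q 0 (suc n), a sum over no tuples
    ≡⟨ antidiag-last n (λ ℓ m → a m ℓ) ⟩
  antidiag n (λ ℓ m → a (suc m) ℓ)
    ≡⟨ antidiag-cong n (λ ℓ m → a-suc m ℓ) ⟩
  antidiag n (λ ℓ m → a m ℓ + antidiag ℓ (λ j k → b j * a m k))
    ≡⟨ antidiag-+ n _ _ ⟩
  rhs n + antidiag n (λ ℓ m → antidiag ℓ (λ j k → b j * a m k))
    ≡⟨ cong (rhs n +_) (antidiag-assoc n (λ j k m → b j * a m k)) ⟩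
  rhs n + antidiag n (λ j s → antidiag s (λ k m → b j * a m k))
    ≡⟨ cong (rhs n +_) (antidiag-cong n (λ j s → antidiag-*ˡ s (b j) _)) ⟩
  rhs n + antidiag n (λ j s → b j * rhs s) ∎

-- Comparison of the two recurrences

r≡rhs : ∀ n → r (suc n) ≡ rhs n
r≡rhs = <-rec (λ n → r (suc n) ≡ rhs n) step
  where
  step : ∀ n → (∀ {m} → m < n → r (suc m) ≡ rhs m) → r (suc n) ≡ rhs n
  step zero    ih = refl
  step (suc n) ih = begin
    r (suc (suc n))                                   ≡⟨ r-suc n ⟩
    r (suc n) + antidiag n (λ k l → b k * r (suc l))  ≡⟨ cong₂ _+_ (ih (n<1+n n)) (antidiag-cong-≡ n tail) ⟩
    rhs n + antidiag n (λ k l → b k * rhs l)          ≡⟨ rhs-suc n ⟨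
    rhs (suc n)                                       ∎
    where
    tail : ∀ k l → k + l ≡ n → b k * r (suc l) ≡ b k * rhs l
    tail k l refl = cong (b k *_) (ih (s≤s (m≤n+m l k)))

theorem3p4 : ∀ (n : ℕ) → 1 ≤ n →
    r n ≡ (∑[ ℓ < suc n ] ∑[ i < n ∸ ℓ ] (((n ∸ ℓ ∸ 1) C i) * q i ℓ))
theorem3p4 (suc n) _ = begin
  r (suc n)                                               ≡⟨ r≡rhs n ⟩
  antidiag n (λ ℓ m → a m ℓ)
    ≡⟨ antidiag-cong n (λ ℓ m → ∑<-antidiag m (λ i _ → (m C i) * q i ℓ)) ⟨
  antidiag n (λ ℓ m → inner ℓ (suc m))
    -- the term ℓ ≡ suc n of the theorem has an empty inner sum
    ≡⟨ antidiag-last n inner ⟨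
  antidiag (suc n) inner                                  ≡⟨ ∑<-antidiag (suc n) inner ⟨
  ∑< (suc (suc n)) (λ ℓ → inner ℓ (suc n ∸ ℓ))            ∎
  where
  inner : ℕ → ℕ → ℕ
  inner ℓ m = ∑< m (λ i → ((m ∸ 1) C i) * q i ℓ)
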